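{- Let $A$ be a finite alphabet, $A^+$ the set of non-empty words over $A$, $H=\sum_{w\in A^+}H_{(w)}$, and $$P=\log(1+H)=\sum_{n=1}^{\infty}\frac{(-1)^{n-1}}{n}H^n .$$ In the basis of complete homogeneous functions, $$P=\sum_{I\ne1}\frac{(-1)^{\ell(I)-1}}{\ell(I)}H_I,$$ where the sum is over all non-empty sentences $I$ over $A$; moreover the series $P$ is primitive with respect to the pruning coproduct: $$\Delta(P)=1\otimes P+P\otimes1 .$$
   Context: $\Bbbk$ is a field of characteristic zero. A sentence $I=(w_1,\dots,w_m)$ over $A$ is a finite sequence of non-empty words in letters of $A$; $\ell(I)=m$; $1$ is the empty sentence; $I\cdot J$ is concatenation of sequences of words. $\mathrm{NSym}_A$ is the Hopf algebra over $\Bbbk$ with linear basis $(H_I)$ (complete homogeneous functions) indexed by sentences, graded by the total number of letters, with $H_1=1$, product $H_IH_J=H_{I\cdot J}$, and (pruning) coproduct the algebra morphism $\Delta$ determined by $\Delta(H_{(w)})=\sum_{uv=w}H_{(u)}\otimes H_{(v)}$ for words $w$ (sum over all factorizations into a possibly empty prefix $u$ and suffix $v$, with $H_{(1)}=1$ for the empty word). A formal series is a possibly infinite combination $G=\sum_I g_IH_I$ with $g_I\in\Bbbk$. Products of series are Cauchy products extending the product of $\mathrm{NSym}_A$; the coproduct is extended by $\Delta(G)=\sum_Ig_I\Delta(H_I)$, understood coefficientwise as a formal series in the elements $H_J\otimes H_K$, and $G_1\otimes G_2$ for series is understood coefficientwise. -}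

module Defs where

open import Level using (Level; _⊔_)
open import Algebra.Apartness.Bundles using (HeytingField; HeytingCommutativeRing)
open import Algebra.Bundles using (CommutativeRing)
import Algebra.Properties.Semiring.Exp as Exp
import Algebra.Properties.Semiring.Mult as Mult
open import Data.Fin.Base using (Fin)
open import Data.Fin.Properties using (inj⇒≟)
open import Data.List.Base as List
  using (List; []; _∷_; _++_; [_]; length; map; foldr; concatMap; cartesianProductWith)
open import Data.List.Membership.Propositional using (_∉_)
open import Data.List.NonEmpty.Base using (List⁺; _∷_; toList)
import Data.List.Properties as List
open import Data.List.Relation.Unary.Unique.Propositional using (Unique)
open import Data.Nat.Base using (ℕ; zero; suc; pred; NonZero)
open import Data.Product.Base using (_×_; _,_; ∃; map₁; uncurry; proj₁)
import Data.Product.Properties as Product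
open import Function.Bundles using (_↔_)
open import Function.Properties.Inverse using (↔⇒↣)
open import Relation.Binary.Definitions using (DecidableEquality)
open import Relation.Binary.PropositionalEquality.Core using (_≡_; refl; cong₂)
open import Relation.Nullary.Decidable using (yes; no; map′; _×-dec_)

module _ {c ℓ₁ ℓ₂} (𝕜 : HeytingField c ℓ₁ ℓ₂) where
  open HeytingField 𝕜 using (_#_; 0#; 1#; heytingCommutativeRing)
  open HeytingCommutativeRing heytingCommutativeRing using (commutativeRing)
  open Mult (CommutativeRing.semiring commutativeRing) using () renaming (_×_ to _×ᵏ_)

  -- Apartness from 0# is the constructive form of being non-zero; it is what makes
  -- the positive integers invertible in 𝕜.
  CharacteristicZero : Set ℓ₂
  CharacteristicZero = ∀ n .{{_ : NonZero n}} → (n ×ᵏ 1#) # 0#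

-- All (u , v) with u ++ v ≡ xs, each exactly once.
splits : ∀ {x} {X : Set x} → List X → List (List X × List X)
splits []       = [ ([] , []) ]
splits (x ∷ xs) = ([] , x ∷ xs) ∷ map (map₁ (x ∷_)) (splits xs)

module NSymSeries {c ℓ₁ ℓ₂ a} (𝕜 : HeytingField c ℓ₁ ℓ₂) (char0 : CharacteristicZero 𝕜)
                  {A : Set a} {k : ℕ} (finite : A ↔ Fin k) where

  open HeytingField 𝕜
    using (Carrier; _≈_; _+_; _*_; -_; 0#; 1#; heytingCommutativeRing; #⇒invertible)
  open HeytingCommutativeRing heytingCommutativeRing using (commutativeRing)
  open Exp (CommutativeRing.semiring commutativeRing) using (_^_)

  private
    variable
      x y : Level
      X : Set x
      Y : Set y

  Word : Set a
  Word = List⁺ A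

  Sentence : Set a
  Sentence = List Word

  _≟ᴬ_ : DecidableEquality A
  _≟ᴬ_ = inj⇒≟ (↔⇒↣ finite)

  _≟ᵂ_ : DecidableEquality Word
  (x ∷ xs) ≟ᵂ (y ∷ ys) =
    map′ (uncurry (cong₂ _∷_)) (λ { refl → refl , refl }) (x ≟ᴬ y ×-dec List.≡-dec _≟ᴬ_ xs ys)

  _≟ˢ_ : DecidableEquality Sentence
  _≟ˢ_ = List.≡-dec _≟ᵂ_

  _≟ˢˢ_ : DecidableEquality (Sentence × Sentence)
  _≟ˢˢ_ = Product.≡-dec _≟ˢ_ _≟ˢ_

  -- The inverse of n · 1 in 𝕜 (#⇒invertible inverts n · 1 - 0).
  1/ : (n : ℕ) .{{_ : NonZero n}} → Carrier
  1/ (suc n) = proj₁ (#⇒invertible (char0 (suc n)))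

  -- (-1)ⁿ⁻¹ / n
  logCoeff : (n : ℕ) .{{_ : NonZero n}} → Carrier
  logCoeff n = (- 1#) ^ pred n * 1/ n

  ∑ : List X → (X → Carrier) → Carrier
  ∑ xs f = foldr _+_ 0# (map f xs)

  -- s is the sum of the family f, all but finitely many of whose terms vanish.
  IsSum : {X : Set x} → (X → Carrier) → Carrier → Set (x ⊔ ℓ₁)
  IsSum f s = ∃ λ xs → Unique xs × (∀ x → x ∉ xs → f x ≈ 0#) × (∑ xs f ≈ s)

  -- The free 𝕜-module on X: (c₁ , x₁) ∷ (c₂ , x₂) ∷ … stands for c₁ x₁ + c₂ x₂ + …;
  -- repetitions are allowed, so elements are to be compared through coeff.
  Combination : Set x → Set (c ⊔ x)
  Combination X = List (Carrier × X)

  coeff : DecidableEquality X → Combination X → X → Carrier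
  coeff {X = X} _≟_ t x = ∑ t term
    where
    term : Carrier × X → Carrier
    term (b , y) with y ≟ x
    ... | yes _ = b
    ... | no  _ = 0#

  _⊗_ : Combination X → Combination Y → Combination (X × Y)
  _⊗_ = cartesianProductWith λ (b , x) (d , y) → b * d , (x , y)

  NSym NSym⊗NSym : Set (c ⊔ a)
  NSym      = Combination Sentence
  NSym⊗NSym = Combination (Sentence × Sentence)

  H : Sentence → NSym
  H I = [ (1# , I) ]

  -- The product of NSym ⊗ NSym, from H_I H_J = H_{I·J} in each factor.
  _∙_ : NSym⊗NSym → NSym⊗NSym → NSym⊗NSym
  _∙_ = cartesianProductWith λ (b , (I , J)) (d , (I′ , J′)) → b * d , (I ++ I′ , J ++ J′)

  -- The sentence (u), read as the empty sentence when u is the empty word.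
  sentence : List A → Sentence
  sentence []       = []
  sentence (x ∷ xs) = [ x ∷ xs ]

  ΔWord : Word → NSym⊗NSym
  ΔWord w = concatMap (λ (u , v) → H (sentence u) ⊗ H (sentence v)) (splits (toList w))

  -- Δ(H_I) for I = (w₁,…,wₘ): as Δ is an algebra morphism, this is Δ(H_(w₁)) ⋯ Δ(H_(wₘ)).
  ΔH : Sentence → NSym⊗NSym
  ΔH I = foldr (λ w t → ΔWord w ∙ t) (H [] ⊗ H []) I

  -- A formal series is its family of coefficients.
  Series Series₂ : Set (c ⊔ a)
  Series  = Sentence → Carrier
  Series₂ = Sentence × Sentence → Carrier

  infix 4 _≋_
  _≋_ : Series → Series → Set (a ⊔ ℓ₁)
  F ≋ G = ∀ I → F I ≈ G I

  𝟏 : Series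
  𝟏 = coeff _≟ˢ_ (H [])

  infixl 7 _·_
  _·_ : Series → Series → Series
  (F · G) I = ∑ (splits I) λ (J , K) → F J * G K

  infixr 8 _^ˢ_
  _^ˢ_ : Series → ℕ → Series
  F ^ˢ zero  = 𝟏
  F ^ˢ suc n = F · F ^ˢ n

  infixl 6 _⊞_
  _⊞_ : Series₂ → Series₂ → Series₂
  (S ⊞ T) JK = S JK + T JK

  infixr 7 _⊠_
  _⊠_ : Series → Series → Series₂
  (F ⊠ G) (J , K) = F J * G K

  -- P = log(1 + G) = ∑_{n ≥ 1} (-1)ⁿ⁻¹/n Gⁿ, coefficientwise (n is shifted by one).
  IsLog[1+_] : Series → Series → Set (a ⊔ ℓ₁)
  IsLog[1+ G ] P = ∀ I → IsSum (λ n → logCoeff (suc n) * (G ^ˢ suc n) I) (P I)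

  -- T = Δ(G) = ∑_I g_I Δ(H_I), coefficientwise.
  IsΔ : Series → Series₂ → Set (a ⊔ ℓ₁)
  IsΔ G T = ∀ J K → IsSum (λ I → G I * coeff _≟ˢˢ_ (ΔH I) (J , K)) (T (J , K))

  IsPrimitive : Series → Set (a ⊔ ℓ₁)
  IsPrimitive G = IsΔ G (𝟏 ⊠ G ⊞ G ⊠ 𝟏)

  -- ∑_w H_(w) over all non-empty words w.
  𝐇 : Series
  𝐇 []          = 0#
  𝐇 (_ ∷ [])    = 1#
  𝐇 (_ ∷ _ ∷ _) = 0#

  -- ∑_{I ≠ 1} (-1)^{ℓ(I)-1}/ℓ(I) H_I
  logExpansion : Series
  logExpansion []        = 0#
  logExpansion I@(_ ∷ _) = logCoeff (length I)

{-# OPTIONS --safe #-}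

-- The coefficient of H_J ⊗ H_K in Δ(H_I) is the multiplicity of I among the quasi-shuffles
-- of J and K, in which a word of J and a word of K may also be concatenated into one word.
-- Quasi-shuffles are lattice paths with steps (1 , 0), (0 , 1) and (1 , 1), a sentence of
-- length n being a path of n steps; so the coefficient of H_J ⊗ H_K in Δ(P) is the sum of
-- (-1)ⁿ⁻¹/n over the paths from (0 , 0) to (p , q), p = ℓ(J), q = ℓ(K). For p , q ≥ 1 it
-- vanishes: by cyclic rotation, p times it is the sum of (-1)ⁿ⁻¹ over the paths whose
-- first step has a horizontal component. Removing that step leaves the paths to (p-1 , q)
-- and those to (p-1 , q-1), which cancel because ∑ (-1)ⁿ over the paths to (p , q)
-- is (-1)^(p+q).
module Submission where

open import Defs
open import Algebra.Apartness.Bundles using (HeytingField; HeytingCommutativeRing)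
open import Algebra.Bundles using (CommutativeRing)
import Algebra.Properties.CommutativeMonoid.Mult as CommutativeMonoidMult
import Algebra.Properties.CommutativeSemigroup as CommutativeSemigroup
import Algebra.Properties.Ring as RingProperties
import Algebra.Properties.Semiring.Exp as Exp
import Algebra.Properties.Semiring.Mult as Mult
import Algebra.Solver.CommutativeMonoid as CommutativeMonoidSolver
open import Data.Fin.Base using (Fin)
open import Data.List.Base as List
  using (List; []; _∷_; _++_; [_]; length; map; concatMap; cartesianProductWith; deduplicate)
import Data.List.Membership.DecPropositional as DecMembership
open import Data.List.Membership.Propositional using (_∈_; _∉_)
open import Data.List.Membership.Propositional.Properties using (∈-deduplicate⁺)
open import Data.List.NonEmpty.Base using (_∷_; toList; _⁺++⁺_)
import Data.List.Properties as List
open import Data.List.Relation.Unary.All using ([]; _∷_; lookup)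
open import Data.List.Relation.Unary.AllPairs using ([]; _∷_)
open import Data.List.Relation.Unary.Any using (here; there)
open import Data.List.Relation.Unary.Unique.Propositional using (Unique)
open import Data.List.Relation.Unary.Unique.DecPropositional.Properties using (deduplicate-!)
open import Data.Nat.Base using (ℕ; zero; suc)
import Data.Nat.Properties as ℕ
open import Data.Product.Base using (_×_; _,_; ∃; proj₁; proj₂; map₁)
import Data.Product.Properties as Product
open import Function.Base using (_∘_)
open import Function.Bundles using (_↔_)
open import Level using (Level)
open import Relation.Binary.Definitions using (DecidableEquality)
open import Relation.Binary.PropositionalEquality as ≡ using (_≡_)
import Relation.Binary.Reasoning.Setoid as SetoidReasoning
open import Relation.Nullary.Decidable using (Dec; yes; no)
open import Relation.Nullary.Negation using (¬_; contradiction)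

-- Weighted sums over Delannoy paths.

module DelannoySums {c ℓ} (R : CommutativeRing c ℓ) where
  open CommutativeRing R hiding (zero)
  open Mult semiring using () renaming (_×_ to _×ᵏ_)
  open CommutativeMonoidMult +-commutativeMonoid using (×-distrib-+)
  open CommutativeMonoidSolver +-commutativeMonoid
    using (_⊕_; _⊜_; solve)
  open SetoidReasoning setoid

  -- ∑ φ(number of steps) over the lattice paths from (0 , 0) to (p , q) with steps
  -- (1 , 0), (0 , 1) and (1 , 1).
  pathSum : (ℕ → Carrier) → ℕ → ℕ → Carrier
  pathSum φ zero    q       = φ q
  pathSum φ (suc p) zero    = φ (suc p)
  pathSum φ (suc p) (suc q) =
    pathSum (φ ∘ suc) p (suc q) + pathSum (φ ∘ suc) (suc p) q + pathSum (φ ∘ suc) p q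

  pathSum-+ : ∀ {φ ψ χ} → (∀ n → φ n ≈ ψ n + χ n) →
              ∀ p q → pathSum φ p q ≈ pathSum ψ p q + pathSum χ p q
  pathSum-+ eq zero    q       = eq q
  pathSum-+ eq (suc p) zero    = eq (suc p)
  pathSum-+ {φ} {ψ} {χ} eq (suc p) (suc q) = begin
    pathSum (φ ∘ suc) p (suc q) + pathSum (φ ∘ suc) (suc p) q + pathSum (φ ∘ suc) p q
      ≈⟨ +-cong (+-cong (pathSum-+ eq′ p (suc q)) (pathSum-+ eq′ (suc p) q)) (pathSum-+ eq′ p q) ⟩
    _ ≈⟨ solve 6 (λ a b c d e f → ((a ⊕ b) ⊕ (c ⊕ d)) ⊕ (e ⊕ f) ⊜ ((a ⊕ c) ⊕ e) ⊕ ((b ⊕ d) ⊕ f))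
           refl _ _ _ _ _ _ ⟩
    pathSum ψ (suc p) (suc q) + pathSum χ (suc p) (suc q) ∎
    where eq′ = eq ∘ suc

  pathSum-0 : ∀ {φ} → (∀ n → φ n ≈ 0#) → ∀ p q → pathSum φ p q ≈ 0#
  pathSum-0 eq zero    q       = eq q
  pathSum-0 eq (suc p) zero    = eq (suc p)
  pathSum-0 {φ} eq (suc p) (suc q) = begin
    pathSum (φ ∘ suc) p (suc q) + pathSum (φ ∘ suc) (suc p) q + pathSum (φ ∘ suc) p q
      ≈⟨ +-cong (+-cong (pathSum-0 eq′ p (suc q)) (pathSum-0 eq′ (suc p) q)) (pathSum-0 eq′ p q) ⟩
    0# + 0# + 0# ≈⟨ +-congʳ (+-identityʳ 0#) ⟩
    0# + 0#      ≈⟨ +-identityʳ 0# ⟩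
    0#           ∎
    where eq′ = eq ∘ suc

  pathSum-cong : ∀ {φ ψ} → (∀ n → φ n ≈ ψ n) → ∀ p q → pathSum φ p q ≈ pathSum ψ p q
  pathSum-cong eq zero    q       = eq q
  pathSum-cong eq (suc p) zero    = eq (suc p)
  pathSum-cong eq (suc p) (suc q) =
    +-cong (+-cong (pathSum-cong eq′ p (suc q)) (pathSum-cong eq′ (suc p) q)) (pathSum-cong eq′ p q)
    where eq′ = eq ∘ suc

  -- Splitting off the first step of the paths to `(suc p , suc q)` leaves one pair that cancels by
  -- induction on `p`; the remaining pair merges into a single path sum with weight
  -- `φ (suc n) + φ n`, which is zero.
  pathSum-alternating : ∀ {φ} → (∀ n → φ (suc n) + φ n ≈ 0#) →
                        ∀ p q → pathSum φ p (suc q) + pathSum φ p q ≈ 0#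
  pathSum-alternating alt zero    q = alt q
  pathSum-alternating {φ} alt (suc p) q = begin
    pathSum (φ ∘ suc) p (suc q) + pathSum (φ ∘ suc) (suc p) q + pathSum (φ ∘ suc) p q
      + pathSum φ (suc p) q
      ≈⟨ solve 4 (λ a b c d → ((a ⊕ b) ⊕ c) ⊕ d ⊜ (a ⊕ c) ⊕ (b ⊕ d)) refl _ _ _ _ ⟩
    (pathSum (φ ∘ suc) p (suc q) + pathSum (φ ∘ suc) p q)
      + (pathSum (φ ∘ suc) (suc p) q + pathSum φ (suc p) q)
      ≈⟨ +-cong (pathSum-alternating (alt ∘ suc) p q) (sym (pathSum-+ (λ _ → refl) (suc p) q)) ⟩
    0# + pathSum (λ n → φ (suc n) + φ n) (suc p) q
      ≈⟨ +-cong refl (pathSum-0 alt (suc p) q) ⟩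
    0# + 0# ≈⟨ +-identityʳ 0# ⟩
    0#      ∎

  -- The paths whose first step has a horizontal component, with that step not counted.
  horizontalFirst : (ℕ → Carrier) → ℕ → ℕ → Carrier
  horizontalFirst φ zero    q       = 0#
  horizontalFirst φ (suc p) zero    = pathSum φ p zero
  horizontalFirst φ (suc p) (suc q) = pathSum φ p (suc q) + pathSum φ p q

  horizontalFirst-+ : ∀ {φ ψ χ} → (∀ n → φ n ≈ ψ n + χ n) →
                      ∀ p q → horizontalFirst φ p q ≈ horizontalFirst ψ p q + horizontalFirst χ p q
  horizontalFirst-+ eq zero    q       = sym (+-identityʳ 0#)
  horizontalFirst-+ eq (suc p) zero    = pathSum-+ eq p zero
  horizontalFirst-+ {φ} {ψ} {χ} eq (suc p) (suc q) = begin
    pathSum φ p (suc q) + pathSum φ p q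
      ≈⟨ +-cong (pathSum-+ eq p (suc q)) (pathSum-+ eq p q) ⟩
    _ ≈⟨ solve 4 (λ a b c d → (a ⊕ b) ⊕ (c ⊕ d) ⊜ (a ⊕ c) ⊕ (b ⊕ d)) refl _ _ _ _ ⟩
    _ ∎

  -- On a path to `(suc p , suc q)` whose first step has a horizontal component, delete the second
  -- step: a path of the same kind to one of the three points on the left remains. Only the single
  -- diagonal step to `(1 , 1)` has no second step; its weight is `ψ zero`, whence the hypothesis.
  horizontalFirst-unfold : ∀ ψ → ψ zero ≈ 0# → ∀ p q →
    horizontalFirst (ψ ∘ suc) p (suc q) + horizontalFirst (ψ ∘ suc) p q
      + horizontalFirst (ψ ∘ suc) (suc p) q
      ≈ pathSum ψ p (suc q) + pathSum ψ p q
  horizontalFirst-unfold ψ ψ0 zero zero = begin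
    0# + 0# + ψ 1  ≈⟨ +-congʳ (+-identityʳ 0#) ⟩
    0# + ψ 1       ≈⟨ +-comm _ _ ⟩
    ψ 1 + 0#       ≈⟨ +-congˡ ψ0 ⟨
    ψ 1 + ψ 0      ∎
  horizontalFirst-unfold ψ ψ0 zero (suc q) = begin
    0# + 0# + _  ≈⟨ +-congʳ (+-identityʳ 0#) ⟩
    0# + _       ≈⟨ +-identityˡ _ ⟩
    _            ∎
  -- The next two clauses differ only in the split on `p`, which lets `pathSum` with second argument
  -- `zero` reduce.
  horizontalFirst-unfold ψ ψ0 (suc zero)    zero =
    solve 3 (λ a b c → ((a ⊕ b) ⊕ b) ⊕ c ⊜ ((a ⊕ c) ⊕ b) ⊕ b) refl _ _ _
  horizontalFirst-unfold ψ ψ0 (suc (suc p)) zero =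
    solve 3 (λ a b c → ((a ⊕ b) ⊕ b) ⊕ c ⊜ ((a ⊕ c) ⊕ b) ⊕ b) refl _ _ _
  horizontalFirst-unfold ψ ψ0 (suc p) (suc q) =
    solve 5 (λ a b c d e → ((a ⊕ b) ⊕ (b ⊕ c)) ⊕ (d ⊕ e) ⊜ ((a ⊕ d) ⊕ b) ⊕ ((b ⊕ e) ⊕ c))
      refl _ _ _ _ _

  -- Cyclic rotation: a path of n steps with a marked step having a horizontal component
  -- (there are p of those) corresponds to a path of n steps starting with such a step
  -- and a choice of one of n rotations.
  pathSum-rotate : ∀ φ p q →
    p ×ᵏ pathSum φ p q ≈ horizontalFirst (λ n → suc n ×ᵏ φ (suc n)) p q
  pathSum-rotate φ zero          q       = refl
  pathSum-rotate φ (suc zero)    zero    = refl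
  pathSum-rotate φ (suc (suc p)) zero    = refl
  pathSum-rotate φ (suc p)       (suc q) = begin
    suc p ×ᵏ (x + y + z)
      ≈⟨ ×-distrib-+ _ _ (suc p) ⟩
    suc p ×ᵏ (x + y) + suc p ×ᵏ z
      ≈⟨ +-congʳ (×-distrib-+ _ _ (suc p)) ⟩
    -- The single copies of `x` and `z` count the paths whose marked step is the first one; the
    -- multiples count later marks. All marks in `y` are later, as its first step is vertical.
    (x + p ×ᵏ x) + suc p ×ᵏ y + (z + p ×ᵏ z)
      ≈⟨ +-cong (+-cong (+-congˡ (pathSum-rotate φ′ p (suc q))) (pathSum-rotate φ′ (suc p) q))
           (+-congˡ (pathSum-rotate φ′ p q)) ⟩
    (x + horizontalFirst (ψ ∘ suc) p (suc q)) + horizontalFirst (ψ ∘ suc) (suc p) q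
      + (z + horizontalFirst (ψ ∘ suc) p q)
      ≈⟨ solve 5 (λ a b c d e → ((a ⊕ b) ⊕ c) ⊕ (d ⊕ e) ⊜ (a ⊕ d) ⊕ ((b ⊕ e) ⊕ c)) refl _ _ _ _ _ ⟩
    (x + z) + (horizontalFirst (ψ ∘ suc) p (suc q) + horizontalFirst (ψ ∘ suc) p q
      + horizontalFirst (ψ ∘ suc) (suc p) q)
      ≈⟨ +-congˡ (horizontalFirst-unfold ψ refl p q) ⟩
    horizontalFirst φ′ (suc p) (suc q) + horizontalFirst ψ (suc p) (suc q)
      -- By definition of the multiple, `suc n ×ᵏ φ (suc n)` is `φ′ n + ψ n`.
      ≈⟨ horizontalFirst-+ {ψ = φ′} {χ = ψ} (λ _ → refl) (suc p) (suc q) ⟨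
    horizontalFirst (λ n → suc n ×ᵏ φ (suc n)) (suc p) (suc q) ∎
    where
    φ′ ψ : ℕ → Carrier
    φ′   = φ ∘ suc
    ψ n  = n ×ᵏ φ′ n
    x = pathSum φ′ p (suc q)
    y = pathSum φ′ (suc p) q
    z = pathSum φ′ p q

module _ {c ℓ₁ ℓ₂ a} (𝕜 : HeytingField c ℓ₁ ℓ₂) (char0 : CharacteristicZero 𝕜)
         {A : Set a} {k : ℕ} (finite : A ↔ Fin k) where

  open NSymSeries 𝕜 char0 finite
  open HeytingField 𝕜 using (heytingCommutativeRing; #⇒invertible)
  open HeytingCommutativeRing heytingCommutativeRing using (commutativeRing)
  open CommutativeRing commutativeRing hiding (zero)
  open CommutativeSemigroup +-commutativeSemigroup using () renaming (interchange to +-interchange)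
  open CommutativeSemigroup *-commutativeSemigroup
    using () renaming (interchange to *-interchange; x∙yz≈y∙xz to x*yz≈y*xz)
  open RingProperties ring using (-1*x≈-x; -0#≈0#)
  open Exp semiring using (_^_)
  open Mult semiring using (×-congʳ; ×-comm-*; ×-assoc-*) renaming (_×_ to _×ᵏ_)
  open DelannoySums commutativeRing
  open SetoidReasoning setoid

  private
    variable
      x y p q r : Level
      X : Set x
      Y : Set y
      P : Set p
      Q : Set q
      R : Set r

  -- Finite sums over lists.

  ∑-cong-∈ : ∀ (xs : List X) {f g} → (∀ {x} → x ∈ xs → f x ≈ g x) → ∑ xs f ≈ ∑ xs g
  ∑-cong-∈ []       eq = refl
  ∑-cong-∈ (x ∷ xs) eq = +-cong (eq (here ≡.refl)) (∑-cong-∈ xs (eq ∘ there))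

  ∑-cong : ∀ (xs : List X) {f g} → (∀ x → f x ≈ g x) → ∑ xs f ≈ ∑ xs g
  ∑-cong xs eq = ∑-cong-∈ xs λ {x} _ → eq x

  ∑-0-∈ : ∀ (xs : List X) {f} → (∀ {x} → x ∈ xs → f x ≈ 0#) → ∑ xs f ≈ 0#
  ∑-0-∈ []       eq = refl
  ∑-0-∈ (x ∷ xs) eq = trans (+-cong (eq (here ≡.refl)) (∑-0-∈ xs (eq ∘ there))) (+-identityʳ 0#)

  ∑-0 : ∀ (xs : List X) {f} → (∀ x → f x ≈ 0#) → ∑ xs f ≈ 0#
  ∑-0 xs eq = ∑-0-∈ xs λ {x} _ → eq x

  ∑-+ : ∀ (xs : List X) (f g : X → Carrier) → ∑ xs (λ x → f x + g x) ≈ ∑ xs f + ∑ xs g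
  ∑-+ []       f g = sym (+-identityʳ 0#)
  ∑-+ (x ∷ xs) f g = trans (+-congˡ (∑-+ xs f g)) (+-interchange _ _ _ _)

  *-distribˡ-∑ : ∀ b (xs : List X) f → b * ∑ xs f ≈ ∑ xs (λ x → b * f x)
  *-distribˡ-∑ b []       f = zeroʳ b
  *-distribˡ-∑ b (x ∷ xs) f = trans (distribˡ b _ _) (+-congˡ (*-distribˡ-∑ b xs f))

  *-distribʳ-∑ : ∀ b (xs : List X) f → ∑ xs f * b ≈ ∑ xs (λ x → f x * b)
  *-distribʳ-∑ b []       f = zeroˡ b
  *-distribʳ-∑ b (x ∷ xs) f = trans (distribʳ b _ _) (+-congˡ (*-distribʳ-∑ b xs f))

  ∑-swap : ∀ (xs : List X) (ys : List Y) (f : X → Y → Carrier) →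
           ∑ xs (λ x → ∑ ys (f x)) ≈ ∑ ys (λ y → ∑ xs (λ x → f x y))
  ∑-swap []       ys f = sym (∑-0 ys λ _ → refl)
  ∑-swap (x ∷ xs) ys f = trans (+-congˡ (∑-swap xs ys f)) (sym (∑-+ ys (f x) _))

  ∑-++ : ∀ (xs ys : List X) f → ∑ (xs ++ ys) f ≈ ∑ xs f + ∑ ys f
  ∑-++ []       ys f = sym (+-identityˡ _)
  ∑-++ (x ∷ xs) ys f = trans (+-congˡ (∑-++ xs ys f)) (sym (+-assoc _ _ _))

  ∑-map : ∀ (h : X → Y) xs f → ∑ (map h xs) f ≈ ∑ xs (f ∘ h)
  ∑-map h []       f = refl
  ∑-map h (x ∷ xs) f = +-congˡ (∑-map h xs f)

  ∑-concatMap : ∀ (h : X → List Y) xs f → ∑ (concatMap h xs) f ≈ ∑ xs (λ x → ∑ (h x) f)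
  ∑-concatMap h []       f = refl
  ∑-concatMap h (x ∷ xs) f = trans (∑-++ (h x) _ f) (+-congˡ (∑-concatMap h xs f))

  ∑-cartesianProductWith : ∀ {z} {Z : Set z} (h : X → Y → Z) xs ys f →
    ∑ (cartesianProductWith h xs ys) f ≈ ∑ xs (λ x → ∑ ys (λ y → f (h x y)))
  ∑-cartesianProductWith h []       ys f = refl
  ∑-cartesianProductWith h (x ∷ xs) ys f =
    trans (∑-++ (map (h x) ys) _ f) (+-cong (∑-map (h x) ys f) (∑-cartesianProductWith h xs ys f))

  -- Indicators of decidable propositions.

  abstract
    -- Kept abstract so that indicators do not reduce and the decision inside can be inferred from
    -- the goal.
    𝟙 : Dec P → Carrier
    𝟙 (yes _) = 1#
    𝟙 (no  _) = 0#

    𝟙-yes : (P? : Dec P) → P → 𝟙 P? ≈ 1#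
    𝟙-yes (yes _) _ = refl
    𝟙-yes (no ¬p) p = contradiction p ¬p

    𝟙-no : (P? : Dec P) → ¬ P → 𝟙 P? ≈ 0#
    𝟙-no (yes p) ¬p = contradiction p ¬p
    𝟙-no (no  _) _  = refl

  𝟙-cong : (P? : Dec P) (Q? : Dec Q) → (P → Q) → (Q → P) → 𝟙 P? ≈ 𝟙 Q?
  𝟙-cong P?@(yes p) Q? f g = trans (𝟙-yes P? p) (sym (𝟙-yes Q? (f p)))
  𝟙-cong P?@(no ¬p) Q? f g = trans (𝟙-no P? ¬p) (sym (𝟙-no Q? (¬p ∘ g)))

  𝟙-yes-* : (P? : Dec P) → P → ∀ b → 𝟙 P? * b ≈ b
  𝟙-yes-* P? p b = trans (*-congʳ (𝟙-yes P? p)) (*-identityˡ b)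

  𝟙-no-* : (P? : Dec P) → ¬ P → ∀ b → 𝟙 P? * b ≈ 0#
  𝟙-no-* P? ¬p b = trans (*-congʳ (𝟙-no P? ¬p)) (zeroˡ b)

  -- `R?` decides any proposition equivalent to the conjunction, which covers equality of pairs and
  -- of non-empty lists alike.
  𝟙-× : (P? : Dec P) (Q? : Dec Q) (R? : Dec R) → (R → P × Q) → (P → Q → R) →
        𝟙 R? ≈ 𝟙 P? * 𝟙 Q?
  𝟙-× P?@(yes p) Q? R? f g =
    trans (𝟙-cong R? Q? (proj₂ ∘ f) (g p)) (sym (𝟙-yes-* P? p _))
  𝟙-× P?@(no ¬p) Q? R? f g = trans (𝟙-no R? (¬p ∘ proj₁ ∘ f)) (sym (𝟙-no-* P? ¬p _))

  -- Sums of finitely supported families.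

  module _ (_≟_ : DecidableEquality X) where

    ∑-𝟙-∉ : ∀ (f : X → Carrier) {x} ys → x ∉ ys → ∑ ys (λ y → 𝟙 (x ≟ y) * f y) ≈ 0#
    ∑-𝟙-∉ f {x} ys x∉ys = ∑-0-∈ ys λ {y} y∈ys →
      𝟙-no-* (x ≟ y) (λ { ≡.refl → x∉ys y∈ys }) _

    ∑-𝟙-∈ : ∀ (f : X → Carrier) {x ys} → Unique ys → x ∈ ys → ∑ ys (λ y → 𝟙 (x ≟ y) * f y) ≈ f x
    ∑-𝟙-∈ f {x} {_ ∷ ys} (x∉ ∷ _) (here ≡.refl) = begin
      𝟙 (x ≟ x) * f x + ∑ ys (λ y → 𝟙 (x ≟ y) * f y)
        ≈⟨ +-cong (𝟙-yes-* (x ≟ x) ≡.refl _) (∑-𝟙-∉ f ys λ x∈ys → lookup x∉ x∈ys ≡.refl) ⟩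
      f x + 0#  ≈⟨ +-identityʳ _ ⟩
      f x       ∎
    ∑-𝟙-∈ f {x} {y ∷ ys} (y∉ ∷ u) (there x∈ys) = begin
      𝟙 (x ≟ y) * f y + ∑ ys (λ y → 𝟙 (x ≟ y) * f y)
        ≈⟨ +-cong (𝟙-no-* (x ≟ y) (lookup y∉ x∈ys ∘ ≡.sym) _) (∑-𝟙-∈ f u x∈ys) ⟩
      0# + f x  ≈⟨ +-identityˡ _ ⟩
      f x       ∎

    𝟙-transport : ∀ (f : X → Carrier) x y → 𝟙 (x ≟ y) * f y ≈ 𝟙 (y ≟ x) * f x
    𝟙-transport f x y with x ≟ y
    ... | x≟y@(yes ≡.refl) = *-congʳ (𝟙-cong x≟y (x ≟ x) ≡.sym ≡.sym)
    ... | x≟y@(no  x≢y)    =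
      trans (𝟙-no-* x≟y x≢y _) (sym (𝟙-no-* (y ≟ x) (x≢y ∘ ≡.sym) _))

    -- Each term over one list is a Kronecker-delta sum over the other, even off that list, since
    -- `f` vanishes there. Exchanging the two sums turns one total into the other.
    IsSum-unique : ∀ {f s t} → IsSum f s → IsSum f t → s ≈ t
    IsSum-unique {f} {s} {t} (xs , xs! , xs-supp , xs-sum) (ys , ys! , ys-supp , ys-sum) = begin
      s                                             ≈⟨ xs-sum ⟨
      ∑ xs f                                        ≈⟨ ∑-cong xs (expand ys! ys-supp) ⟨
      ∑ xs (λ x → ∑ ys (λ y → 𝟙 (x ≟ y) * f y))    ≈⟨ ∑-swap xs ys _ ⟩
      ∑ ys (λ y → ∑ xs (λ x → 𝟙 (x ≟ y) * f y))    ≈⟨ ∑-cong ys (λ y → ∑-cong xs λ x → 𝟙-transport f x y) ⟩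
      ∑ ys (λ y → ∑ xs (λ x → 𝟙 (y ≟ x) * f x))    ≈⟨ ∑-cong ys (expand xs! xs-supp) ⟩
      ∑ ys f                                        ≈⟨ ys-sum ⟩
      t                                             ∎
      where
      expand : ∀ {zs} → Unique zs → (∀ z → z ∉ zs → f z ≈ 0#) →
               ∀ x → ∑ zs (λ z → 𝟙 (x ≟ z) * f z) ≈ f x
      expand {zs} zs! supp x with DecMembership._∈?_ _≟_ x zs
      ... | yes x∈zs = ∑-𝟙-∈ f zs! x∈zs
      ... | no  x∉zs = trans (∑-𝟙-∉ f zs x∉zs) (sym (supp x x∉zs))

    -- A list sum with repetitions is regrouped by value: `m` counts occurrences, so the
    -- deduplicated list supports the family. Both the logarithm and the coproduct are summed this
    -- way.
    IsSum-multiplicity : ∀ (f m : X → Carrier) zs → (∀ x → m x ≈ ∑ zs (λ z → 𝟙 (z ≟ x))) →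
                         IsSum (λ x → f x * m x) (∑ zs f)
    IsSum-multiplicity f m zs m≈ =
      xs , deduplicate-! _≟_ zs , supp , sum
      where
      xs = deduplicate _≟_ zs
      supp : ∀ x → x ∉ xs → f x * m x ≈ 0#
      supp x x∉xs = trans (*-congˡ (trans (m≈ x) (∑-0-∈ zs λ {z} z∈zs →
        𝟙-no (z ≟ x) λ { ≡.refl → x∉xs (∈-deduplicate⁺ _≟_ z∈zs) }))) (zeroʳ _)
      sum : ∑ xs (λ x → f x * m x) ≈ ∑ zs f
      sum = begin
        ∑ xs (λ x → f x * m x)
          ≈⟨ ∑-cong xs (λ x → trans (*-congˡ (m≈ x)) (trans (*-comm _ _) (*-distribʳ-∑ (f x) zs _))) ⟩
        ∑ xs (λ x → ∑ zs (λ z → 𝟙 (z ≟ x) * f x))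
          ≈⟨ ∑-swap xs zs _ ⟩
        ∑ zs (λ z → ∑ xs (λ x → 𝟙 (z ≟ x) * f x))
          ≈⟨ ∑-cong-∈ zs (λ z∈zs → ∑-𝟙-∈ f (deduplicate-! _≟_ zs) (∈-deduplicate⁺ _≟_ z∈zs)) ⟩
        ∑ zs f ∎

    -- Replaces the local case split of `coeff` by indicators, which can be exchanged with other
    -- sums.
    coeff≈∑ : ∀ (t : Combination X) x → coeff _≟_ t x ≈ ∑ t (λ (b , y) → b * 𝟙 (y ≟ x))
    coeff≈∑ []            x = refl
    coeff≈∑ ((b , y) ∷ t) x with y ≟ x
    ... | y≟x@(yes eq) =
      +-cong (sym (trans (*-comm b _) (𝟙-yes-* y≟x eq b))) (coeff≈∑ t x)
    ... | y≟x@(no neq) =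
      +-cong (sym (trans (*-comm b _) (𝟙-no-* y≟x neq b))) (coeff≈∑ t x)

  IsSum-resp : ∀ {f g : X → Carrier} {s t} → (∀ x → f x ≈ g x) → s ≈ t → IsSum f s → IsSum g t
  IsSum-resp f≈g s≈t (xs , xs! , supp , sum) =
    xs , xs! , (λ x x∉ → trans (sym (f≈g x)) (supp x x∉)) ,
    trans (∑-cong xs (λ x → sym (f≈g x))) (trans sum s≈t)

  -- The logarithm

  -- Only the splitting with prefix `[ w ]` survives, because `𝐇` vanishes on the empty sentence and
  -- on sentences of two or more words.
  𝐇-·-∷ : ∀ G w I → (𝐇 · G) (w ∷ I) ≈ G I
  𝐇-·-∷ G w I = begin
    0# * G (w ∷ I) + ∑ (map (map₁ (w ∷_)) (splits I)) (λ (J , K) → 𝐇 J * G K)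
      ≈⟨ +-cong (zeroˡ _) (∑-map _ (splits I) _) ⟩
    0# + ∑ (splits I) (λ (J , K) → 𝐇 (w ∷ J) * G K)
      ≈⟨ +-identityˡ _ ⟩
    ∑ (splits I) (λ (J , K) → 𝐇 (w ∷ J) * G K)
      ≈⟨ onlyEmptyPrefix I ⟩
    G I ∎
    where
    onlyEmptyPrefix : ∀ I → ∑ (splits I) (λ (J , K) → 𝐇 (w ∷ J) * G K) ≈ G I
    onlyEmptyPrefix []      = trans (+-identityʳ _) (*-identityˡ _)
    onlyEmptyPrefix (v ∷ I) = begin
      1# * G (v ∷ I) + ∑ (map (map₁ (v ∷_)) (splits I)) (λ (J , K) → 𝐇 (w ∷ J) * G K)
        ≈⟨ +-cong (*-identityˡ _) (trans (∑-map _ (splits I) _) (∑-0 (splits I) λ _ → zeroˡ _)) ⟩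
      G (v ∷ I) + 0#  ≈⟨ +-identityʳ _ ⟩
      G (v ∷ I)       ∎

  -- A sentence factors into one-word sentences in exactly one way, with as many factors as it has
  -- words.
  𝐇^-coefficient : ∀ n I → (𝐇 ^ˢ n) I ≈ 𝟙 (n ℕ.≟ length I)
  𝐇^-coefficient zero    []      = trans (+-identityʳ 1#) (sym (𝟙-yes (0 ℕ.≟ 0) ≡.refl))
  𝐇^-coefficient zero    (w ∷ I) = trans (+-identityʳ 0#) (sym (𝟙-no (0 ℕ.≟ suc (length I)) λ ()))
  𝐇^-coefficient (suc n) []      =
    trans (+-identityʳ _) (trans (zeroˡ _) (sym (𝟙-no (suc n ℕ.≟ 0) λ ())))
  𝐇^-coefficient (suc n) (w ∷ I) = begin
    (𝐇 · 𝐇 ^ˢ n) (w ∷ I)           ≈⟨ 𝐇-·-∷ (𝐇 ^ˢ n) w I ⟩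
    (𝐇 ^ˢ n) I                      ≈⟨ 𝐇^-coefficient n I ⟩
    𝟙 (n ℕ.≟ length I)              ≈⟨ 𝟙-cong _ _ (≡.cong suc) ℕ.suc-injective ⟩
    𝟙 (suc n ℕ.≟ suc (length I))    ∎

  logExpansion-isLog : IsLog[1+ 𝐇 ] logExpansion
  logExpansion-isLog []        = [] , [] , (λ n _ → vanish n) , refl
    where
    vanish : ∀ n → logCoeff (suc n) * (𝐇 ^ˢ suc n) [] ≈ 0#
    vanish n = trans
      (*-congˡ (trans (𝐇^-coefficient (suc n) []) (𝟙-no (suc n ℕ.≟ 0) λ ()))) (zeroʳ _)
  logExpansion-isLog I@(_ ∷ I′) = IsSum-resp (λ _ → refl) (+-identityʳ _)
    -- The exponent is `suc n`, so the only contributing index is one less than the length of `I`.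
    (IsSum-multiplicity ℕ._≟_ (λ n → logCoeff (suc n)) (λ n → (𝐇 ^ˢ suc n) I) [ length I′ ] λ n →
      trans (𝐇^-coefficient (suc n) I)
        (trans (𝟙-cong _ _ (≡.sym ∘ ℕ.suc-injective) (≡.cong suc ∘ ≡.sym)) (sym (+-identityʳ _))))

  -- The pruning coproduct

  Letters : Set a
  Letters = List A

  _≟ᴸ_ : DecidableEquality Letters
  _≟ᴸ_ = List.≡-dec _≟ᴬ_

  _≟ᴸᴸ_ : DecidableEquality (Letters × Letters)
  _≟ᴸᴸ_ = Product.≡-dec _≟ᴸ_ _≟ᴸ_

  -- Every factorization occurs exactly once in `splits xs`. For empty `U` only the first entry can
  -- match; otherwise only a later one can, and the first letters must agree.
  ∑-splits-𝟙 : ∀ xs U V → ∑ (splits xs) (λ s → 𝟙 (s ≟ᴸᴸ (U , V))) ≈ 𝟙 (xs ≟ᴸ (U ++ V))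
  ∑-splits-𝟙 [] U V = trans (+-identityʳ _) (𝟙-cong _ _ (λ { ≡.refl → ≡.refl }) (λ eq →
    ≡.sym (≡.cong₂ _,_ (List.++-conicalˡ U V (≡.sym eq)) (List.++-conicalʳ U V (≡.sym eq)))))
  ∑-splits-𝟙 (x ∷ xs) [] V = begin
    𝟙 (([] , x ∷ xs) ≟ᴸᴸ ([] , V)) + ∑ (map (map₁ (x ∷_)) (splits xs)) (λ s → 𝟙 (s ≟ᴸᴸ ([] , V)))
      ≈⟨ +-cong (𝟙-cong _ ((x ∷ xs) ≟ᴸ V) (λ { ≡.refl → ≡.refl }) (λ { ≡.refl → ≡.refl }))
           (trans (∑-map _ (splits xs) _) (∑-0 (splits xs) λ _ → 𝟙-no _ λ ())) ⟩
    𝟙 ((x ∷ xs) ≟ᴸ V) + 0#  ≈⟨ +-identityʳ _ ⟩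
    𝟙 ((x ∷ xs) ≟ᴸ V)       ∎
  ∑-splits-𝟙 (x ∷ xs) (y ∷ U) V = begin
    𝟙 (([] , x ∷ xs) ≟ᴸᴸ (y ∷ U , V))
      + ∑ (map (map₁ (x ∷_)) (splits xs)) (λ s → 𝟙 (s ≟ᴸᴸ (y ∷ U , V)))
      ≈⟨ +-cong (𝟙-no _ λ ()) (∑-map _ (splits xs) _) ⟩
    0# + ∑ (splits xs) (λ s → 𝟙 (map₁ (x ∷_) s ≟ᴸᴸ (y ∷ U , V)))
      ≈⟨ +-identityˡ _ ⟩
    ∑ (splits xs) (λ s → 𝟙 (map₁ (x ∷_) s ≟ᴸᴸ (y ∷ U , V)))
      ≈⟨ ∑-cong (splits xs) (λ s → 𝟙-× (x ≟ᴬ y) (s ≟ᴸᴸ (U , V)) _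
           (λ { ≡.refl → ≡.refl , ≡.refl }) (λ { ≡.refl ≡.refl → ≡.refl })) ⟩
    ∑ (splits xs) (λ s → 𝟙 (x ≟ᴬ y) * 𝟙 (s ≟ᴸᴸ (U , V)))
      ≈⟨ *-distribˡ-∑ _ (splits xs) _ ⟨
    𝟙 (x ≟ᴬ y) * ∑ (splits xs) (λ s → 𝟙 (s ≟ᴸᴸ (U , V)))
      ≈⟨ *-congˡ (∑-splits-𝟙 xs U V) ⟩
    𝟙 (x ≟ᴬ y) * 𝟙 (xs ≟ᴸ (U ++ V))
      ≈⟨ 𝟙-× _ _ _ (λ { ≡.refl → ≡.refl , ≡.refl }) (λ { ≡.refl ≡.refl → ≡.refl }) ⟨
    𝟙 ((x ∷ xs) ≟ᴸ (y ∷ U ++ V)) ∎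

  -- All (u , J′) with sentence u ++ J′ ≡ J.
  peel : Sentence → List (Letters × Sentence)
  peel []      = [ ([] , []) ]
  peel (j ∷ J) = ([] , j ∷ J) ∷ (toList j , J) ∷ []

  peel₂ : Sentence → Sentence → List ((Letters × Letters) × (Sentence × Sentence))
  peel₂ J K = cartesianProductWith (λ (U , R) (V , S) → (U , V) , (R , S)) (peel J) (peel K)

  -- `peel J` lists each solution of `sentence u ++ J′ ≡ J` once. Summing over solutions separates
  -- the condition on `u` from the one on `J′`.
  ∑-peel-𝟙 : ∀ u J′ J → 𝟙 ((sentence u ++ J′) ≟ˢ J) ≈
             ∑ (peel J) (λ (U , R) → 𝟙 (u ≟ᴸ U) * 𝟙 (J′ ≟ˢ R))
  ∑-peel-𝟙 []      J′ [] = sym (trans (+-identityʳ _) (𝟙-yes-* ([] ≟ᴸ []) ≡.refl _))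
  ∑-peel-𝟙 (x ∷ u) J′ [] = trans (𝟙-no (((x ∷ u) ∷ J′) ≟ˢ []) λ ())
    (sym (trans (+-identityʳ _) (𝟙-no-* ((x ∷ u) ≟ᴸ []) (λ ()) _)))
  ∑-peel-𝟙 []      J′ (j ∷ J) = sym (begin
    𝟙 ([] ≟ᴸ []) * 𝟙 (J′ ≟ˢ (j ∷ J)) + (𝟙 ([] ≟ᴸ toList j) * 𝟙 (J′ ≟ˢ J) + 0#)
      ≈⟨ +-cong (𝟙-yes-* ([] ≟ᴸ []) ≡.refl _)
           (trans (+-identityʳ _) (𝟙-no-* ([] ≟ᴸ toList j) (λ ()) _)) ⟩
    𝟙 (J′ ≟ˢ (j ∷ J)) + 0#  ≈⟨ +-identityʳ _ ⟩
    𝟙 (J′ ≟ˢ (j ∷ J))       ∎)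
  ∑-peel-𝟙 (x ∷ u) J′ (j@(_ ∷ _) ∷ J) = sym (begin
    𝟙 ((x ∷ u) ≟ᴸ []) * 𝟙 (J′ ≟ˢ (j ∷ J)) + (𝟙 ((x ∷ u) ≟ᴸ toList j) * 𝟙 (J′ ≟ˢ J) + 0#)
      ≈⟨ +-cong (𝟙-no-* ((x ∷ u) ≟ᴸ []) (λ ()) _) (+-identityʳ _) ⟩
    0# + 𝟙 ((x ∷ u) ≟ᴸ toList j) * 𝟙 (J′ ≟ˢ J)
      ≈⟨ +-identityˡ _ ⟩
    𝟙 ((x ∷ u) ≟ᴸ toList j) * 𝟙 (J′ ≟ˢ J)
      ≈⟨ 𝟙-× _ _ _ (λ { ≡.refl → ≡.refl , ≡.refl }) (λ { ≡.refl ≡.refl → ≡.refl }) ⟨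
    𝟙 (((x ∷ u) ∷ J′) ≟ˢ (j ∷ J)) ∎)

  ∑-peel₂-𝟙 : ∀ u v J′ K′ J K →
    𝟙 ((sentence u ++ J′ , sentence v ++ K′) ≟ˢˢ (J , K)) ≈
    ∑ (peel₂ J K) (λ (UV , RS) → 𝟙 ((u , v) ≟ᴸᴸ UV) * 𝟙 ((J′ , K′) ≟ˢˢ RS))
  ∑-peel₂-𝟙 u v J′ K′ J K = begin
    𝟙 ((sentence u ++ J′ , sentence v ++ K′) ≟ˢˢ (J , K))
      ≈⟨ 𝟙-× _ _ _ Product.,-injective (≡.cong₂ _,_) ⟩
    𝟙 ((sentence u ++ J′) ≟ˢ J) * 𝟙 ((sentence v ++ K′) ≟ˢ K)
      ≈⟨ *-cong (∑-peel-𝟙 u J′ J) (∑-peel-𝟙 v K′ K) ⟩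
    ∑ (peel J) (λ (U , R) → 𝟙 (u ≟ᴸ U) * 𝟙 (J′ ≟ˢ R))
      * ∑ (peel K) (λ (V , S) → 𝟙 (v ≟ᴸ V) * 𝟙 (K′ ≟ˢ S))
      ≈⟨ *-distribʳ-∑ _ (peel J) _ ⟩
    ∑ (peel J) (λ (U , R) → 𝟙 (u ≟ᴸ U) * 𝟙 (J′ ≟ˢ R)
      * ∑ (peel K) (λ (V , S) → 𝟙 (v ≟ᴸ V) * 𝟙 (K′ ≟ˢ S)))
      ≈⟨ ∑-cong (peel J) (λ (U , R) → trans (*-distribˡ-∑ _ (peel K) _) (∑-cong (peel K) λ (V , S) →
           trans (*-interchange _ _ _ _) (*-cong
             (sym (𝟙-× _ _ _ Product.,-injective (≡.cong₂ _,_)))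
             (sym (𝟙-× _ _ _ Product.,-injective (≡.cong₂ _,_)))))) ⟩
    ∑ (peel J) (λ (U , R) → ∑ (peel K) λ (V , S) →
      𝟙 ((u , v) ≟ᴸᴸ (U , V)) * 𝟙 ((J′ , K′) ≟ˢˢ (R , S)))
      ≈⟨ ∑-cartesianProductWith _ (peel J) (peel K) _ ⟨
    ∑ (peel₂ J K) (λ (UV , RS) → 𝟙 ((u , v) ≟ᴸᴸ UV) * 𝟙 ((J′ , K′) ≟ˢˢ RS)) ∎

  -- Multiplicativity of the coproduct gives a recursion on the first word: its prefix and suffix
  -- are peeled off `J` and `K`, and the rest of the sentence accounts for what remains.
  coeff-ΔH-∷ : ∀ w I J K → coeff _≟ˢˢ_ (ΔH (w ∷ I)) (J , K) ≈
    ∑ (peel₂ J K) (λ ((U , V) , RS) → 𝟙 (toList w ≟ᴸ (U ++ V)) * coeff _≟ˢˢ_ (ΔH I) RS)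
  coeff-ΔH-∷ w I J K = begin
    coeff _≟ˢˢ_ (ΔWord w ∙ ΔH I) (J , K)
      ≈⟨ coeff≈∑ _≟ˢˢ_ (ΔWord w ∙ ΔH I) (J , K) ⟩
    ∑ (ΔWord w ∙ ΔH I) (λ (b , x) → b * 𝟙 (x ≟ˢˢ (J , K)))
      ≈⟨ trans (∑-cartesianProductWith _ (ΔWord w) (ΔH I) _) (∑-concatMap ΔFactorization s _) ⟩
    -- The factor `1# * 1#` and the final `0#` come from the one-term list
    -- `H (sentence u) ⊗ H (sentence v)`.
    ∑ s (λ (u , v) → ∑ (ΔH I) (λ (d , (J′ , K′)) →
      1# * 1# * d * 𝟙 ((sentence u ++ J′ , sentence v ++ K′) ≟ˢˢ (J , K))) + 0#)
      ≈⟨ ∑-cong s (λ (u , v) → trans (+-identityʳ _) (∑-cong (ΔH I) λ (d , (J′ , K′)) →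
           *-cong (trans (*-congʳ (*-identityˡ 1#)) (*-identityˡ d)) (∑-peel₂-𝟙 u v J′ K′ J K))) ⟩
    ∑ s (λ uv → ∑ (ΔH I) (λ (d , x) →
      d * ∑ (peel₂ J K) (λ (UV , RS) → 𝟙 (uv ≟ᴸᴸ UV) * 𝟙 (x ≟ˢˢ RS))))
      ≈⟨ ∑-cong s (λ uv → trans
           (∑-cong (ΔH I) λ (d , x) → trans (*-distribˡ-∑ d (peel₂ J K) _)
             (∑-cong (peel₂ J K) λ _ → x*yz≈y*xz _ _ _))
           (trans (∑-swap (ΔH I) (peel₂ J K) _)
             (∑-cong (peel₂ J K) λ (UV , RS) → trans (sym (*-distribˡ-∑ _ (ΔH I) _))
               (*-congˡ (sym (coeff≈∑ _≟ˢˢ_ (ΔH I) RS)))))) ⟩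
    ∑ s (λ uv → ∑ (peel₂ J K) (λ (UV , RS) → 𝟙 (uv ≟ᴸᴸ UV) * coeff _≟ˢˢ_ (ΔH I) RS))
      ≈⟨ ∑-swap s (peel₂ J K) _ ⟩
    ∑ (peel₂ J K) (λ (UV , RS) → ∑ s (λ uv → 𝟙 (uv ≟ᴸᴸ UV) * coeff _≟ˢˢ_ (ΔH I) RS))
      ≈⟨ ∑-cong (peel₂ J K) (λ ((U , V) , RS) → trans (sym (*-distribʳ-∑ _ s _))
           (*-congʳ (∑-splits-𝟙 (toList w) U V))) ⟩
    ∑ (peel₂ J K) (λ ((U , V) , RS) → 𝟙 (toList w ≟ᴸ (U ++ V)) * coeff _≟ˢˢ_ (ΔH I) RS) ∎
    where
    s = splits (toList w)
    ΔFactorization : Letters × Letters → NSym⊗NSym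
    ΔFactorization (u , v) = H (sentence u) ⊗ H (sentence v)

  -- Quasi-shuffles as the dual description of the coproduct.

  quasiShuffles : Sentence → Sentence → List Sentence
  quasiShuffles []      K       = [ K ]
  quasiShuffles (j ∷ J) []      = [ j ∷ J ]
  quasiShuffles (j ∷ J) (k ∷ K) =
    map (k ∷_) (quasiShuffles (j ∷ J) K) ++
    map (j ∷_) (quasiShuffles J (k ∷ K)) ++
    map ((j ⁺++⁺ k) ∷_) (quasiShuffles J K)

  quasiShuffles-[] : ∀ J → quasiShuffles J [] ≡ [ J ]
  quasiShuffles-[] []      = ≡.refl
  quasiShuffles-[] (_ ∷ _) = ≡.refl

  multiplicity : List Sentence → Sentence → Carrier
  multiplicity Is I = ∑ Is (λ I′ → 𝟙 (I′ ≟ˢ I))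

  -- `U` is kept apart from `toList v` because peeling a word from `J` alone yields
  -- `toList j ++ []`.
  𝟙-∷ : ∀ v J w I {U} → toList v ≡ U → 𝟙 ((v ∷ J) ≟ˢ (w ∷ I)) ≈ 𝟙 (toList w ≟ᴸ U) * 𝟙 (J ≟ˢ I)
  𝟙-∷ (y ∷ ys) J (x ∷ xs) I ≡.refl =
    𝟙-× _ _ _ (λ { ≡.refl → ≡.refl , ≡.refl }) (λ { ≡.refl ≡.refl → ≡.refl })

  multiplicity-map-∷ : ∀ v Is w I {U} → toList v ≡ U →
    multiplicity (map (v ∷_) Is) (w ∷ I) ≈ 𝟙 (toList w ≟ᴸ U) * multiplicity Is I
  multiplicity-map-∷ v Is w I eq = begin
    multiplicity (map (v ∷_) Is) (w ∷ I)
      ≈⟨ trans (∑-map _ Is _) (∑-cong Is λ J → 𝟙-∷ v J w I eq) ⟩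
    _ ≈⟨ *-distribˡ-∑ _ Is _ ⟨
    _ ∎

  -- The entries of `peel₂ J K` with `U` or `V` non-empty are the possible first words of a
  -- quasi-shuffle. The entry with both empty contributes zero since `w` is non-empty.
  multiplicity-quasiShuffles-∷ : ∀ w I J K →
    multiplicity (quasiShuffles J K) (w ∷ I) ≈
    ∑ (peel₂ J K) (λ ((U , V) , (R , S)) →
      𝟙 (toList w ≟ᴸ (U ++ V)) * multiplicity (quasiShuffles R S) I)
  multiplicity-quasiShuffles-∷ w I [] [] = +-congʳ
    (trans (𝟙-no ([] ≟ˢ (w ∷ I)) λ ()) (sym (𝟙-no-* (toList w ≟ᴸ []) (λ ()) _)))
  multiplicity-quasiShuffles-∷ w I [] (k ∷ K) = begin
    𝟙 ((k ∷ K) ≟ˢ (w ∷ I)) + 0#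
      ≈⟨ multiplicity-map-∷ k [ K ] w I ≡.refl ⟩
    𝟙 (toList w ≟ᴸ toList k) * multiplicity [ K ] I
      ≈⟨ +-identityʳ _ ⟨
    𝟙 (toList w ≟ᴸ toList k) * multiplicity [ K ] I + 0#
      ≈⟨ +-identityˡ _ ⟨
    0# + (𝟙 (toList w ≟ᴸ toList k) * multiplicity [ K ] I + 0#)
      ≈⟨ +-congʳ (𝟙-no-* (toList w ≟ᴸ []) (λ ()) _) ⟨
    _ ∎
  multiplicity-quasiShuffles-∷ w I (j ∷ J) [] = begin
    𝟙 ((j ∷ J) ≟ˢ (w ∷ I)) + 0#
      ≈⟨ multiplicity-map-∷ j [ J ] w I (≡.sym (List.++-identityʳ (toList j))) ⟩
    𝟙 (toList w ≟ᴸ (toList j ++ [])) * multiplicity [ J ] I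
      ≡⟨ ≡.cong (λ Is → _ * multiplicity Is I) (≡.sym (quasiShuffles-[] J)) ⟩
    𝟙 (toList w ≟ᴸ (toList j ++ [])) * multiplicity (quasiShuffles J []) I
      ≈⟨ +-identityʳ _ ⟨
    𝟙 (toList w ≟ᴸ (toList j ++ [])) * multiplicity (quasiShuffles J []) I + 0#
      ≈⟨ +-identityˡ _ ⟨
    0# + (𝟙 (toList w ≟ᴸ (toList j ++ [])) * multiplicity (quasiShuffles J []) I + 0#)
      ≈⟨ +-congʳ (𝟙-no-* (toList w ≟ᴸ []) (λ ()) _) ⟨
    _ ∎
  multiplicity-quasiShuffles-∷ w I (j@(_ ∷ _) ∷ J) (k@(_ ∷ _) ∷ K) = begin
    multiplicity (quasiShuffles (j ∷ J) (k ∷ K)) (w ∷ I)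
      ≈⟨ trans (∑-++ (map (k ∷_) (quasiShuffles (j ∷ J) K)) _ _)
           (+-congˡ (∑-++ (map (j ∷_) (quasiShuffles J (k ∷ K))) _ _)) ⟩
    multiplicity (map (k ∷_) (quasiShuffles (j ∷ J) K)) (w ∷ I)
      + (multiplicity (map (j ∷_) (quasiShuffles J (k ∷ K))) (w ∷ I)
      + multiplicity (map ((j ⁺++⁺ k) ∷_) (quasiShuffles J K)) (w ∷ I))
      ≈⟨ +-cong (multiplicity-map-∷ k (quasiShuffles (j ∷ J) K) w I ≡.refl)
           (+-cong (multiplicity-map-∷ j (quasiShuffles J (k ∷ K)) w I (≡.sym (List.++-identityʳ (toList j))))
             (trans (multiplicity-map-∷ (j ⁺++⁺ k) (quasiShuffles J K) w I ≡.refl)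
               (sym (+-identityʳ _)))) ⟩
    _ ≈⟨ +-identityˡ _ ⟨
    _ ≈⟨ +-congʳ (𝟙-no-* (toList w ≟ᴸ []) (λ ()) _) ⟨
    _ ∎

  -- Both sides obey the same recursion on the first word of `I`, and for empty `I` both detect
  -- whether `J` and `K` are empty.
  coeff-ΔH : ∀ I J K → coeff _≟ˢˢ_ (ΔH I) (J , K) ≈ multiplicity (quasiShuffles J K) I
  coeff-ΔH [] J K = begin
    coeff _≟ˢˢ_ (ΔH []) (J , K)
      ≈⟨ coeff≈∑ _≟ˢˢ_ (ΔH []) (J , K) ⟩
    1# * 1# * 𝟙 (([] , []) ≟ˢˢ (J , K)) + 0#
      ≈⟨ +-cong (trans (*-congʳ (*-identityˡ 1#)) (*-identityˡ _)) refl ⟩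
    𝟙 (([] , []) ≟ˢˢ (J , K)) + 0#
      ≈⟨ base J K ⟩
    multiplicity (quasiShuffles J K) [] ∎
    where
    noEmpty : ∀ v Is → multiplicity (map (v ∷_) Is) [] ≈ 0#
    noEmpty v Is = trans (∑-map _ Is _) (∑-0 Is λ I → 𝟙-no ((v ∷ I) ≟ˢ []) λ ())
    base : ∀ J K → 𝟙 (([] , []) ≟ˢˢ (J , K)) + 0# ≈ multiplicity (quasiShuffles J K) []
    base []      []      = +-congʳ (𝟙-cong _ _ (λ _ → ≡.refl) (λ _ → ≡.refl))
    base []      (k ∷ K) = +-congʳ (𝟙-cong _ ((k ∷ K) ≟ˢ []) (λ ()) (λ ()))
    base (j ∷ J) []      = +-congʳ (𝟙-cong _ ((j ∷ J) ≟ˢ []) (λ ()) (λ ()))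
    base (j ∷ J) (k ∷ K) = sym (begin
      multiplicity (quasiShuffles (j ∷ J) (k ∷ K)) []
        ≈⟨ trans (∑-++ (map (k ∷_) (quasiShuffles (j ∷ J) K)) _ _)
             (+-congˡ (∑-++ (map (j ∷_) (quasiShuffles J (k ∷ K))) _ _)) ⟩
      _ ≈⟨ +-cong (noEmpty k (quasiShuffles (j ∷ J) K))
             (trans (+-cong (noEmpty j (quasiShuffles J (k ∷ K))) (noEmpty (j ⁺++⁺ k) (quasiShuffles J K)))
               (+-identityʳ 0#)) ⟩
      0# + 0#
        ≈⟨ +-congʳ (𝟙-no (([] , []) ≟ˢˢ (j ∷ J , k ∷ K)) λ ()) ⟨
      _ ∎)
  coeff-ΔH (w ∷ I) J K = begin
    coeff _≟ˢˢ_ (ΔH (w ∷ I)) (J , K)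
      ≈⟨ coeff-ΔH-∷ w I J K ⟩
    ∑ (peel₂ J K) (λ ((U , V) , RS) → 𝟙 (toList w ≟ᴸ (U ++ V)) * coeff _≟ˢˢ_ (ΔH I) RS)
      ≈⟨ ∑-cong (peel₂ J K) (λ (_ , (R , S)) → *-congˡ (coeff-ΔH I R S)) ⟩
    _ ≈⟨ multiplicity-quasiShuffles-∷ w I J K ⟨
    multiplicity (quasiShuffles J K) (w ∷ I) ∎

  ∑-quasiShuffles : ∀ φ J K →
    ∑ (quasiShuffles J K) (φ ∘ length) ≈ pathSum φ (length J) (length K)
  ∑-quasiShuffles φ []      K       = +-identityʳ _
  ∑-quasiShuffles φ (_ ∷ _) []      = +-identityʳ _
  ∑-quasiShuffles φ (j ∷ J) (k ∷ K) = begin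
    ∑ (quasiShuffles (j ∷ J) (k ∷ K)) (φ ∘ length)
      ≈⟨ trans (∑-++ (map (k ∷_) (quasiShuffles (j ∷ J) K)) _ _)
           (+-congˡ (∑-++ (map (j ∷_) (quasiShuffles J (k ∷ K))) _ _)) ⟩
    _ ≈⟨ +-cong (step k (j ∷ J) K) (+-cong (step j J (k ∷ K)) (step (j ⁺++⁺ k) J K)) ⟩
    pathSum (φ ∘ suc) (length (j ∷ J)) (length K)
      + (pathSum (φ ∘ suc) (length J) (length (k ∷ K)) + pathSum (φ ∘ suc) (length J) (length K))
      ≈⟨ +-assoc _ _ _ ⟨
    -- `quasiShuffles` puts the word of `K` first, whereas `pathSum` starts with the horizontal
    -- step, which belongs to `J`.
    _ ≈⟨ +-congʳ (+-comm _ _) ⟩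
    pathSum φ (length (j ∷ J)) (length (k ∷ K)) ∎
    where
    step : ∀ v J K → ∑ (map (v ∷_) (quasiShuffles J K)) (φ ∘ length) ≈
                     pathSum (φ ∘ suc) (length J) (length K)
    step v J K = trans (∑-map _ (quasiShuffles J K) _) (∑-quasiShuffles (φ ∘ suc) J K)

  -- Only the finitely many quasi-shuffles of `J` and `K` contribute at `(J , K)`, so every series
  -- has a coproduct.
  IsΔ-quasiShuffles : ∀ G → IsΔ G (λ (J , K) → ∑ (quasiShuffles J K) G)
  IsΔ-quasiShuffles G J K =
    IsSum-multiplicity _≟ˢ_ G _ (quasiShuffles J K) λ I → coeff-ΔH I J K

  -- Primitivity

  1/-inverse : ∀ n → (suc n ×ᵏ 1#) * 1/ (suc n) ≈ 1#
  1/-inverse n = begin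
    (suc n ×ᵏ 1#) * 1/ (suc n)         ≈⟨ *-congʳ (trans (+-congˡ -0#≈0#) (+-identityʳ _)) ⟨
    ((suc n ×ᵏ 1#) - 0#) * 1/ (suc n)  ≈⟨ proj₂ (proj₂ (#⇒invertible (char0 (suc n)))) ⟩
    1#                                 ∎

  -- Division by a positive integer, available in characteristic zero; it removes the factor
  -- introduced by cyclic rotation.
  ×-cancel-0 : ∀ n {x} → suc n ×ᵏ x ≈ 0# → x ≈ 0#
  ×-cancel-0 n {x} nx≈0 = begin
    x                                  ≈⟨ *-identityˡ x ⟨
    1# * x                             ≈⟨ *-congʳ (1/-inverse n) ⟨
    (suc n ×ᵏ 1#) * 1/ (suc n) * x     ≈⟨ *-congʳ (*-comm _ _) ⟩
    1/ (suc n) * (suc n ×ᵏ 1#) * x     ≈⟨ *-assoc _ _ _ ⟩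
    1/ (suc n) * ((suc n ×ᵏ 1#) * x)   ≈⟨ *-congˡ (×-assoc-* (suc n) 1# x) ⟩
    1/ (suc n) * (suc n ×ᵏ (1# * x))   ≈⟨ *-congˡ (×-congʳ (suc n) (*-identityˡ x)) ⟩
    1/ (suc n) * (suc n ×ᵏ x)          ≈⟨ *-congˡ nx≈0 ⟩
    1/ (suc n) * 0#                    ≈⟨ zeroʳ _ ⟩
    0#                                 ∎

  -- The value at `zero` encodes the absence of the empty sentence from the expansion.
  logCoeff₀ : ℕ → Carrier
  logCoeff₀ zero    = 0#
  logCoeff₀ (suc n) = logCoeff (suc n)

  logExpansion≈ : ∀ I → logExpansion I ≈ logCoeff₀ (length I)
  logExpansion≈ []      = refl
  logExpansion≈ (_ ∷ _) = refl

  -- Rotation multiplies the weight of a path by its number of steps, which turns the logarithmic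
  -- weights into alternating signs.
  n×logCoeff : ∀ n → suc n ×ᵏ logCoeff (suc n) ≈ (- 1#) ^ n
  n×logCoeff n = begin
    suc n ×ᵏ ((- 1#) ^ n * 1/ (suc n))          ≈⟨ ×-comm-* (suc n) _ _ ⟨
    (- 1#) ^ n * (suc n ×ᵏ 1/ (suc n))          ≈⟨ *-congˡ (×-congʳ (suc n) (*-identityˡ _)) ⟨
    (- 1#) ^ n * (suc n ×ᵏ (1# * 1/ (suc n)))   ≈⟨ *-congˡ (×-assoc-* (suc n) 1# _) ⟨
    (- 1#) ^ n * ((suc n ×ᵏ 1#) * 1/ (suc n))   ≈⟨ *-congˡ (1/-inverse n) ⟩
    (- 1#) ^ n * 1#                             ≈⟨ *-identityʳ _ ⟩
    (- 1#) ^ n                                  ∎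

  pathSum-logCoeff : ∀ p q → pathSum logCoeff₀ (suc p) (suc q) ≈ 0#
  pathSum-logCoeff p q = ×-cancel-0 p (begin
    suc p ×ᵏ pathSum logCoeff₀ (suc p) (suc q)
      ≈⟨ pathSum-rotate logCoeff₀ (suc p) (suc q) ⟩
    -- The two sums are over the paths left after a first step `(1 , 0)` and after a first step
    -- `(1 , 1)`.
    _ ≈⟨ +-cong (pathSum-cong n×logCoeff p (suc q)) (pathSum-cong n×logCoeff p q) ⟩
    pathSum ((- 1#) ^_) p (suc q) + pathSum ((- 1#) ^_) p q
      ≈⟨ pathSum-alternating (λ n → trans (+-congʳ (-1*x≈-x _)) (-‿inverseˡ _)) p q ⟩
    0# ∎)

  -- If `J` or `K` is empty, the other is the only quasi-shuffle, and one term on the right vanishes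
  -- because the logarithm has no constant term. If neither is empty, both sides are zero.
  ∑-quasiShuffles-log : ∀ J K →
    ∑ (quasiShuffles J K) logExpansion ≈ (𝟏 ⊠ logExpansion ⊞ logExpansion ⊠ 𝟏) (J , K)
  ∑-quasiShuffles-log [] K = begin
    logExpansion K + 0#
      ≈⟨ +-cong (*-identityˡ _) (zeroˡ _) ⟨
    1# * logExpansion K + 0# * 𝟏 K
      ≈⟨ +-congʳ (*-congʳ (+-identityʳ 1#)) ⟨
    𝟏 [] * logExpansion K + 0# * 𝟏 K ∎
  ∑-quasiShuffles-log J@(_ ∷ _) [] = begin
    logExpansion J + 0#
      ≈⟨ +-comm _ _ ⟩
    0# + logExpansion J
      ≈⟨ +-cong (zeroʳ _) (trans (*-congˡ (+-identityʳ 1#)) (*-identityʳ _)) ⟨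
    𝟏 J * 0# + logExpansion J * 𝟏 [] ∎
  ∑-quasiShuffles-log J@(_ ∷ J′) K@(_ ∷ K′) = begin
    ∑ (quasiShuffles J K) logExpansion
      ≈⟨ ∑-cong (quasiShuffles J K) logExpansion≈ ⟩
    ∑ (quasiShuffles J K) (logCoeff₀ ∘ length)
      ≈⟨ ∑-quasiShuffles logCoeff₀ J K ⟩
    pathSum logCoeff₀ (length J) (length K)
      ≈⟨ pathSum-logCoeff (length J′) (length K′) ⟩
    0#
      ≈⟨ +-identityʳ 0# ⟨
    0# + 0#
      -- At a non-empty sentence `𝟏` computes to `0# + 0#`.
      ≈⟨ +-cong (trans (*-congʳ (+-identityʳ 0#)) (zeroˡ _)) (trans (*-congˡ (+-identityʳ 0#)) (zeroʳ _)) ⟨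
    𝟏 J * logExpansion K + logExpansion J * 𝟏 K ∎

  logExpansion-isPrimitive : IsPrimitive logExpansion
  logExpansion-isPrimitive J K =
    IsSum-resp (λ _ → refl) (∑-quasiShuffles-log J K) (IsΔ-quasiShuffles logExpansion J K)

  -- Carries primitivity from the explicit expansion to any series that satisfies the defining
  -- property of the logarithm.
  IsPrimitive-resp : ∀ {F G} → F ≋ G → IsPrimitive F → IsPrimitive G
  IsPrimitive-resp F≋G prim J K = IsSum-resp (λ I → *-congʳ (F≋G I))
    (+-cong (*-congˡ (F≋G K)) (*-congʳ (F≋G J))) (prim J K)

  log-unique : ∀ {F G H} → IsLog[1+ F ] G → IsLog[1+ F ] H → G ≋ H
  log-unique isLogG isLogH I = IsSum-unique ℕ._≟_ (isLogG I) (isLogH I)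

proposition6p7 : ∀ {c ℓ₁ ℓ₂ a} (𝕜 : HeytingField c ℓ₁ ℓ₂) (char0 : CharacteristicZero 𝕜)
    (A : Set a) {k : ℕ} (finite : A ↔ Fin k) →
    let open NSymSeries 𝕜 char0 finite in
    (∃ λ (P : Series) → IsLog[1+ 𝐇 ] P) ×
    (∀ (P : Series) → IsLog[1+ 𝐇 ] P → (P ≋ logExpansion) × IsPrimitive P)
proposition6p7 𝕜 char0 A finite =
  (NSymSeries.logExpansion 𝕜 char0 finite , logExpansion-isLog 𝕜 char0 finite) ,
  λ P isLog →
    log-unique 𝕜 char0 finite isLog (logExpansion-isLog 𝕜 char0 finite) ,
    IsPrimitive-resp 𝕜 char0 finite
      (log-unique 𝕜 char0 finite (logExpansion-isLog 𝕜 char0 finite) isLog)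
      (logExpansion-isPrimitive 𝕜 char0 finite)
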